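{- For all integers $k\ge 1$ and $\ell\ge 1$, there are only finitely many $k$-vertex-critical $(2P_2,(3,\ell)\text{ - }squid)$-free graphs.
   Context: Graphs are finite and simple, and "finitely many" means up to isomorphism. A graph $G$ is $k$-vertex-critical if $\chi(G)=k$ and $\chi(G-v)<k$ for all $v\in V(G)$, where $\chi$ denotes the chromatic number. A graph is $(H_1,H_2)$-free if it contains no induced subgraph isomorphic to $H_1$ or $H_2$. $2P_2$ is the disjoint union of two edges. For $\ell\ge 1$, the $(3,\ell)$-$squid$ is the graph obtained from a triangle $C_3$ by attaching $\ell$ leaves (pendant vertices) to a single vertex of the triangle. -}

module Defs where

open import Data.Fin using (Fin; suc; punchIn)
open import Data.Fin.Patterns using (0F; 1F; 2F; 3F)
open import Data.List using (List)
open import Data.List.Relation.Unary.Any using (Any)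
open import Data.Nat using (ℕ; suc; pred; _+_; _≤_; _<_)
open import Data.Product using (Σ; ∃; ∃-syntax; _×_; proj₂)
open import Level using (0ℓ)
open import Relation.Binary using (Rel; Symmetric; Irreflexive; Decidable)
open import Relation.Binary.Construct.Closure.Symmetric using (SymClosure; fwd; bwd; symmetric)
open import Relation.Binary.Morphism.Structures using (IsOrderMonomorphism; IsOrderIsomorphism)
open import Relation.Binary.PropositionalEquality using (_≡_; _≢_; refl)
open import Relation.Nullary using (¬_; yes; no)

-- Finite simple graphs, labelled by Fin n.  Adjacency is required to be
-- decidable, so that a finite graph is a finite object constructively.
record Graph (n : ℕ) : Set₁ where
  field
    Adj    : Rel (Fin n) 0ℓ
    sym    : Symmetric Adj
    irrefl : Irreflexive _≡_ Adj
    adj?   : Decidable Adj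

open Graph

-- The library's order isomorphisms and monomorphisms are stated for arbitrary
-- relations; here the relation is adjacency.  Monomorphisms are injective and
-- both preserve and reflect adjacency, so their images are induced subgraphs.
_≅_ : ∀ {m n} → Graph m → Graph n → Set
G ≅ H = ∃[ f ] IsOrderIsomorphism _≡_ _≡_ (Adj G) (Adj H) f

_InducedSubgraphOf_ : ∀ {m n} → Graph m → Graph n → Set
H InducedSubgraphOf G = ∃[ f ] IsOrderMonomorphism _≡_ _≡_ (Adj H) (Adj G) f

⟨_,_⟩-free : ∀ {l m n} → Graph l → Graph m → Graph n → Set
⟨ H₁ , H₂ ⟩-free G = ¬ (H₁ InducedSubgraphOf G) × ¬ (H₂ InducedSubgraphOf G)

-- punchIn v enumerates the vertices other than v.
_─_ : ∀ {n} → Graph n → Fin n → Graph (pred n)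
_─_ {suc n} G v = record
  { Adj    = λ x y → Adj G (punchIn v x) (punchIn v y)
  ; sym    = sym G
  ; irrefl = λ { refl → irrefl G refl }
  ; adj?   = λ x y → adj? G (punchIn v x) (punchIn v y)
  }

Colourable : ∀ {n} → ℕ → Graph n → Set
Colourable {n} k G = Σ (Fin n → Fin k) λ c → ∀ {x y} → Adj G x y → c x ≢ c y

-- χ G ≡ k, as a relation between G and k.
HasChromaticNumber : ∀ {n} → Graph n → ℕ → Set
HasChromaticNumber G k = Colourable k G × (∀ m → Colourable m G → k ≤ m)

VertexCritical : ∀ {n} → ℕ → Graph n → Set
VertexCritical k G =
  HasChromaticNumber G k × (∀ v → ∃[ m ] HasChromaticNumber (G ─ v) m × m < k)

-- A class of graphs is finite up to isomorphism when some finite list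
-- represents every isomorphism type in it; listed graphs outside the class are
-- harmless.
FinitelyMany : (∀ {n} → Graph n → Set) → Set₁
FinitelyMany P =
  Σ (List (∃ Graph)) λ Hs → ∀ {n} (G : Graph n) → P G → Any (λ H → G ≅ proj₂ H) Hs

fromEdges : ∀ {n} (E : Rel (Fin n) 0ℓ) → Irreflexive _≡_ E → Decidable E → Graph n
fromEdges E E-irrefl E? = record
  { Adj    = SymClosure E
  ; sym    = symmetric E
  ; irrefl = λ { x≡y (fwd e) → E-irrefl x≡y e ; refl (bwd e) → E-irrefl refl e }
  ; adj?   = dec
  }
  where
  dec : Decidable (SymClosure E)
  dec x y with E? x y | E? y x
  ... | yes e | _     = yes (fwd e)
  ... | no _  | yes e = yes (bwd e)
  ... | no ¬e | no ¬f = no λ { (fwd e) → ¬e e ; (bwd f) → ¬f f }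

data 2P₂-Edge : Rel (Fin 4) 0ℓ where
  left  : 2P₂-Edge 0F 1F
  right : 2P₂-Edge 2F 3F

2P₂ : Graph 4
2P₂ = fromEdges 2P₂-Edge (λ { refl () }) dec
  where
  dec : Decidable 2P₂-Edge
  dec 0F 0F = no λ ()
  dec 0F 1F = yes left
  dec 0F 2F = no λ ()
  dec 0F 3F = no λ ()
  dec 1F _  = no λ ()
  dec 2F 0F = no λ ()
  dec 2F 1F = no λ ()
  dec 2F 2F = no λ ()
  dec 2F 3F = yes right
  dec 3F _  = no λ ()

-- Vertices 0, 1, 2 form the triangle; the other ℓ vertices are the leaves,
-- all attached to 0.
data SquidEdge {ℓ} : Rel (Fin (3 + ℓ)) 0ℓ where
  side₀₁ : SquidEdge 0F 1F
  side₀₂ : SquidEdge 0F 2F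
  side₁₂ : SquidEdge 1F 2F
  leaf   : ∀ i → SquidEdge 0F (suc (suc (suc i)))

squid₃ : ∀ ℓ → Graph (3 + ℓ)
squid₃ ℓ = fromEdges SquidEdge (λ { refl () }) dec
  where
  dec : Decidable (SquidEdge {ℓ})
  dec 0F            0F                  = no λ ()
  dec 0F            1F                  = yes side₀₁
  dec 0F            2F                  = yes side₀₂
  dec 0F            (suc (suc (suc i))) = yes (leaf i)
  dec 1F            0F                  = no λ ()
  dec 1F            1F                  = no λ ()
  dec 1F            2F                  = yes side₁₂
  dec 1F            (suc (suc (suc _))) = no λ ()
  dec (suc (suc _)) _                   = no λ ()

{-# OPTIONS --safe #-}
module Submission where

-- Fix a k-colouring of G and a colour class S. For vertices u, v put A_u = N(u) ∩ S.
-- As G is 2P₂-free, A_u and A_v are nested when u ≁ v; as G is squid-free,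
-- A_u and A_v are disjoint or |A_u \ A_v| < ℓ when u ~ v. By criticality no
-- neighbourhood contains another, so any s ∈ S is separated from any other t ∈ S
-- by a neighbour of s. If A_u is a smallest set containing s, every separator of s
-- from an element of A_u is adjacent to u, hence misses few elements of A_u; the
-- largest missed sets are pairwise not nested, so they come from differently
-- coloured vertices, there are at most k of them, and they cover A_u \ {s}. Thus
-- |A_u| ≤ 1 + kℓ. Likewise the largest of these smallest sets number at most k and
-- cover S, so |S| ≤ k(1 + kℓ), and G has at most k²(1 + kℓ) vertices.

open import Defs
open import Data.Nat using (ℕ; zero; suc; _+_; _*_; _^_; _≤_; _<_; z≤n; s≤s; _≤?_)
open import Data.Nat.Properties
  using (≤-trans; ≤-reflexive; <⇒≱; ≰⇒≥; ≤-pred; m≤n⇒m≤1+n; +-mono-≤; +-suc; module ≤-Reasoning)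
open import Data.Fin using (Fin; zero; suc; punchIn; punchOut; inject≤; _≟_) renaming (_<_ to _<ᶠ_)
open import Data.Fin.Base using (finToFun; funToFin)
open import Data.Fin.Patterns using (0F; 1F; 2F; 3F)
open import Data.Fin.Properties
  using (<-cmp; any?; punchIn-punchOut; punchInᵢ≢i; toℕ-inject≤; finToFun-funToFin)
open import Data.List using (List; []; _∷_; length; filter; allFin; lookup; upTo; concatMap; tabulate)
open import Data.List.Extrema.Nat
  using (argmax; argmin; argmax-sel; argmin-all; f[xs]≤f[argmax]; f[⊥]≤f[argmax]; f[argmin]≤f[xs])
open import Data.List.Membership.Propositional using (_∈_)
open import Data.List.Membership.Propositional.Properties
  using (∈-filter⁺; ∈-filter⁻; ∈-allFin; ∈-lookup; ∈-upTo⁺)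
open import Data.List.Properties using (filter-notAll; length-tabulate)
open import Data.List.Relation.Unary.All as All using ([]; _∷_)
open import Data.List.Relation.Unary.AllPairs using (AllPairs; []; _∷_)
open import Data.List.Relation.Unary.Any as Any using (here; there)
open import Data.List.Relation.Unary.Any.Properties using (concatMap⁺; tabulate⁺)
open import Data.List.Relation.Unary.Unique.Propositional using (Unique)
import Data.List.Relation.Unary.Unique.Propositional.Properties as Unique
open import Data.Product using (∃; _×_; _,_; proj₁; proj₂)
open import Data.Sum using (_⊎_; inj₁; inj₂)
open import Function using (_∘_; id)
open import Level using (0ℓ)
open import Relation.Binary using (Rel; tri<; tri≈; tri>) renaming (Decidable to Decidable₂)
open import Relation.Binary.Construct.Closure.Symmetric using (SymClosure; fwd; bwd)
open import Relation.Binary.Morphism.Structures using (IsOrderMonomorphism)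
open import Relation.Binary.PropositionalEquality
  using (_≡_; _≢_; refl; sym; trans; cong; subst; subst₂; ≢-sym)
open import Relation.Nullary using (¬_; yes; no; ¬?; contradiction; _×-dec_)
open import Relation.Nullary.Decidable using (decidable-stable)
open import Relation.Unary using (Pred; Decidable)

-- Counting with filtered lists.

private variable
  A : Set

module _ {P Q : Pred A 0ℓ} (P? : Decidable P) (Q? : Decidable Q) where

  length-filter-mono-≤ : ∀ xs → (∀ {x} → x ∈ xs → P x → Q x) →
    length (filter P? xs) ≤ length (filter Q? xs)
  length-filter-mono-≤ []       P⊆Q = z≤n
  length-filter-mono-≤ (x ∷ xs) P⊆Q
    with ih ← length-filter-mono-≤ xs (P⊆Q ∘ there) | P? x | Q? x
  ... | yes p | yes _ = s≤s ih
  ... | yes p | no ¬q = contradiction (P⊆Q (here refl) p) ¬q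
  ... | no _  | yes _ = m≤n⇒m≤1+n ih
  ... | no _  | no _  = ih

  length-filter-mono-< : ∀ {xs y} → (∀ {x} → x ∈ xs → P x → Q x) → y ∈ xs → ¬ P y → Q y →
    length (filter P? xs) < length (filter Q? xs)
  length-filter-mono-< {x ∷ xs} P⊆Q (here refl) ¬p q with P? x | Q? x
  ... | yes p | _     = contradiction p ¬p
  ... | no _  | yes _ = s≤s (length-filter-mono-≤ xs (P⊆Q ∘ there))
  ... | no _  | no ¬q = contradiction q ¬q
  length-filter-mono-< {x ∷ xs} P⊆Q (there y∈xs) ¬p q
    with ih ← length-filter-mono-< (P⊆Q ∘ there) y∈xs ¬p q | P? x | Q? x
  ... | yes p | yes _ = s≤s ih
  ... | yes p | no ¬q = contradiction (P⊆Q (here refl) p) ¬q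
  ... | no _  | yes _ = m≤n⇒m≤1+n ih
  ... | no _  | no _  = ih

module _ {P : Pred A 0ℓ} (P? : Decidable P) where

  length-filter-split : ∀ xs →
    length xs ≡ length (filter P? xs) + length (filter (¬? ∘ P?) xs)
  length-filter-split []       = refl
  length-filter-split (x ∷ xs) with ih ← length-filter-split xs | P? x
  ... | yes _ = cong suc ih
  ... | no _  = trans (cong suc ih) (sym (+-suc _ _))

  length-filter-filter-≤ : ∀ {Q : Pred A 0ℓ} (Q? : Decidable Q) xs →
    length (filter P? (filter Q? xs)) ≤ length (filter P? xs)
  length-filter-filter-≤ Q? []       = z≤n
  length-filter-filter-≤ Q? (x ∷ xs) with ih ← length-filter-filter-≤ Q? xs | Q? x
  ... | yes _ with P? x
  ...   | yes _ = s≤s ih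
  ...   | no _  = ih
  length-filter-filter-≤ Q? (x ∷ xs) | no _ with P? x
  ...   | yes _ = m≤n⇒m≤1+n ih
  ...   | no _  = ih

Unique-constant⇒length≤1 : ∀ {a : A} {xs} → Unique xs → (∀ {x} → x ∈ xs → a ≡ x) → length xs ≤ 1
Unique-constant⇒length≤1 {xs = []}         _                  _  = z≤n
Unique-constant⇒length≤1 {xs = x ∷ []}     _                  _  = s≤s z≤n
Unique-constant⇒length≤1 {xs = x ∷ y ∷ _} ((x≢y ∷ _) ∷ _) a≡ =
  contradiction (trans (sym (a≡ (here refl))) (a≡ (there (here refl)))) x≢y

AllPairs-lookup : ∀ {R : Rel A 0ℓ} {xs} → AllPairs R xs →
  ∀ {i j} → i <ᶠ j → R (lookup xs i) (lookup xs j)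
AllPairs-lookup (r ∷ _)  {zero}  {suc j} _         = All.lookup r (∈-lookup j)
AllPairs-lookup (_ ∷ rs) {suc i} {suc j} (s≤s i<j) = AllPairs-lookup rs i<j

-- A greedy covering bound.

module _ {k} (colour : A → Fin k) (μ : A → ℕ) {R : Rel A 0ℓ} (R? : Decidable₂ R) {b : ℕ} where

  -- Greedy: an element x of maximal measure accounts for at most b elements,
  -- and what remains never uses the colour of x again.
  private
    cover-available : ∀ n (colours : List (Fin k)) (xs : List A) → length colours ≤ n →
      (∀ {x} → x ∈ xs → colour x ∈ colours) →
      (∀ {x y} → x ∈ xs → y ∈ xs → ¬ R x y → colour x ≢ colour y ⊎ μ x < μ y) →
      (∀ {x} → x ∈ xs → length (filter (R? x) xs) ≤ b) →
      length xs ≤ n * b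
    cover-available n       colours []        _  _     _     _     = z≤n
    cover-available zero    []      (x ∷ _)   _  avail _     _     with () ← avail (here refl)
    cover-available (suc n) colours xs@(z ∷ zs) len avail differ small = begin
      length xs                               ≡⟨ length-filter-split (R? p) xs ⟩
      length (filter (R? p) xs) + length rest ≤⟨ +-mono-≤ (small p∈xs) rest≤ ⟩
      b + n * b                               ∎
      where
      open ≤-Reasoning
      p : A
      p = argmax μ z zs
      p∈xs : p ∈ xs
      p∈xs with argmax-sel μ z zs
      ... | inj₁ p≡z  = here p≡z
      ... | inj₂ p∈zs = there p∈zs
      p-max : ∀ {x} → x ∈ xs → μ x ≤ μ p
      p-max (here refl)  = f[⊥]≤f[argmax] {f = μ} z zs
      p-max (there x∈zs) = All.lookup (f[xs]≤f[argmax] {f = μ} z zs) x∈zs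
      rest : List A
      rest = filter (¬? ∘ R? p) xs
      rest⊆xs : ∀ {x} → x ∈ rest → x ∈ xs
      rest⊆xs = proj₁ ∘ ∈-filter⁻ (¬? ∘ R? p)
      new-colour : ∀ {x} → x ∈ rest → colour p ≢ colour x
      new-colour x∈rest with x∈xs , ¬Rpx ← ∈-filter⁻ (¬? ∘ R? p) x∈rest
        with differ p∈xs x∈xs ¬Rpx
      ... | inj₁ p≢x = p≢x
      ... | inj₂ p<x = contradiction (p-max x∈xs) (<⇒≱ p<x)
      other? : Decidable (colour p ≢_)
      other? = ¬? ∘ (colour p ≟_)
      rest≤ : length rest ≤ n * b
      rest≤ = cover-available n (filter other? colours) rest
        (≤-pred (≤-trans (filter-notAll other? colours
                            (Any.map (λ eq ≢ → ≢ eq) (avail p∈xs))) len))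
        (λ x∈ → ∈-filter⁺ other? (avail (rest⊆xs x∈)) (new-colour x∈))
        (λ x∈ y∈ → differ (rest⊆xs x∈) (rest⊆xs y∈))
        (λ x∈ → ≤-trans (length-filter-filter-≤ (R? _) (¬? ∘ R? p) xs) (small (rest⊆xs x∈)))

  -- Read `R x y` as: x accounts for y. With y = x the first hypothesis forces `R x x`. The bound is
  -- applied to separators inside one neighbourhood, to tightest neighbours inside an independent
  -- set, and to the colour classes themselves.
  cover : ∀ {xs} →
    (∀ {x y} → x ∈ xs → y ∈ xs → ¬ R x y → colour x ≢ colour y ⊎ μ x < μ y) →
    (∀ {x} → x ∈ xs → length (filter (R? x) xs) ≤ b) →
    length xs ≤ k * b
  cover = cover-available k (allFin k) _ (≤-reflexive (length-tabulate id)) (λ _ → ∈-allFin _)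

-- Induced copies of `2P₂` and of squids.

-- Both relations are symmetric and `Adj` is irreflexive, so trichotomy reduces everything to pairs
-- x < y. This fits `2P₂-Edge` and `SquidEdge`, whose edges all point upwards.
SymClosure-embedding : ∀ {m n} {E : Rel (Fin m) 0ℓ} (G : Graph n) (f : Fin m → Fin n) →
  (∀ {x y} → E x y → Graph.Adj G (f x) (f y)) →
  (∀ {x y} → x <ᶠ y → Graph.Adj G (f x) (f y) → E x y) →
  (∀ {x y} → x <ᶠ y → f x ≢ f y) →
  IsOrderMonomorphism _≡_ _≡_ (SymClosure E) (Graph.Adj G) f
SymClosure-embedding {E = E} G f preserve reflect distinct = record
  { isOrderHomomorphism = record
    { cong = cong f
    ; mono = λ { (fwd e) → preserve e ; (bwd e) → Graph.sym G (preserve e) }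
    }
  ; injective = injective
  ; cancel    = cancel
  }
  where
  injective : ∀ {x y} → f x ≡ f y → x ≡ y
  injective {x} {y} fx≡fy with <-cmp x y
  ... | tri< x<y _ _ = contradiction fx≡fy (distinct x<y)
  ... | tri≈ _ x≡y _ = x≡y
  ... | tri> _ _ y<x = contradiction (sym fx≡fy) (distinct y<x)
  cancel : ∀ {x y} → Graph.Adj G (f x) (f y) → SymClosure E x y
  cancel {x} {y} a with <-cmp x y
  ... | tri< x<y _ _  = fwd (reflect x<y a)
  ... | tri≈ _ refl _ = contradiction a (Graph.irrefl G refl)
  ... | tri> _ _ y<x  = bwd (reflect y<x (Graph.sym G a))

module _ {n} (G : Graph n) where
  open Graph G renaming (sym to Adj-sym; irrefl to Adj-irrefl)

  Adj⇒≢ : ∀ {x y} → Adj x y → x ≢ y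
  Adj⇒≢ a refl = Adj-irrefl refl a

  separated⇒≢ : ∀ {x y z} → Adj x z → ¬ Adj y z → x ≢ y
  separated⇒≢ a ¬a refl = ¬a a

  2P₂-induced : ∀ {a b c d} → Adj a b → Adj c d →
    ¬ Adj a c → ¬ Adj a d → ¬ Adj b c → ¬ Adj b d → 2P₂ InducedSubgraphOf G
  2P₂-induced {a} {b} {c} {d} ab cd ¬ac ¬ad ¬bc ¬bd =
    f , SymClosure-embedding G f (λ { left → ab ; right → cd }) reflect distinct
    where
    f : Fin 4 → Fin n
    f 0F = a
    f 1F = b
    f 2F = c
    f 3F = d
    reflect : ∀ {x y} → x <ᶠ y → Adj (f x) (f y) → 2P₂-Edge x y
    reflect {0F} {1F} _ _ = left
    reflect {0F} {2F} _ e = contradiction e ¬ac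
    reflect {0F} {3F} _ e = contradiction e ¬ad
    reflect {1F} {2F} _ e = contradiction e ¬bc
    reflect {1F} {3F} _ e = contradiction e ¬bd
    reflect {2F} {3F} _ _ = right
    reflect {1F} {1F} (s≤s ())
    reflect {2F} {1F} (s≤s ())
    reflect {2F} {2F} (s≤s (s≤s ()))
    reflect {3F} {1F} (s≤s ())
    reflect {3F} {2F} (s≤s (s≤s ()))
    reflect {3F} {3F} (s≤s (s≤s (s≤s ())))
    distinct : ∀ {x y} → x <ᶠ y → f x ≢ f y
    distinct {0F} {1F} _ = Adj⇒≢ ab
    -- Vertices of different edges are told apart by a neighbour: b is adjacent to a but not to c.
    distinct {0F} {2F} _ = separated⇒≢ ab (¬bc ∘ Adj-sym)
    distinct {0F} {3F} _ = separated⇒≢ ab (¬bd ∘ Adj-sym)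
    distinct {1F} {2F} _ = separated⇒≢ (Adj-sym ab) (¬ac ∘ Adj-sym)
    distinct {1F} {3F} _ = separated⇒≢ (Adj-sym ab) (¬ad ∘ Adj-sym)
    distinct {2F} {3F} _ = Adj⇒≢ cd
    distinct {1F} {1F} (s≤s ())
    distinct {2F} {1F} (s≤s ())
    distinct {2F} {2F} (s≤s (s≤s ()))
    distinct {3F} {1F} (s≤s ())
    distinct {3F} {2F} (s≤s (s≤s ()))
    distinct {3F} {3F} (s≤s (s≤s (s≤s ())))

  squid-induced : ∀ {ℓ u v s} (leaves : List (Fin n)) → Unique leaves → ℓ ≤ length leaves →
    Adj u v → Adj u s → Adj v s →
    (∀ {x} → x ∈ leaves → Adj u x) → (∀ {x} → x ∈ leaves → ¬ Adj v x) →
    (∀ {x} → x ∈ leaves → ¬ Adj s x) → (∀ {x y} → x ∈ leaves → y ∈ leaves → ¬ Adj x y) →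
    squid₃ ℓ InducedSubgraphOf G
  squid-induced {ℓ} {u} {v} {s} leaves unique ℓ≤ uv us vs u~ v≁ s≁ indep =
    f , SymClosure-embedding G f preserve reflect distinct
    where
    g : Fin ℓ → Fin n
    -- The list may be longer than ℓ; its first ℓ entries become the leaves.
    g i = lookup leaves (inject≤ i ℓ≤)
    g∈ : ∀ i → g i ∈ leaves
    g∈ i = ∈-lookup (inject≤ i ℓ≤)
    f : Fin (3 + ℓ) → Fin n
    f 0F                  = u
    f 1F                  = v
    f 2F                  = s
    f (suc (suc (suc i))) = g i
    preserve : ∀ {x y} → SquidEdge x y → Adj (f x) (f y)
    preserve side₀₁   = uv
    preserve side₀₂   = us
    preserve side₁₂   = vs
    preserve (leaf i) = u~ (g∈ i)
    reflect : ∀ {x y} → x <ᶠ y → Adj (f x) (f y) → SquidEdge x y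
    reflect {0F} {1F}                _ _ = side₀₁
    reflect {0F} {2F}                _ _ = side₀₂
    reflect {0F} {suc (suc (suc i))} _ _ = leaf i
    reflect {1F} {2F}                _ _ = side₁₂
    reflect {1F} {suc (suc (suc i))} _ e = contradiction e (v≁ (g∈ i))
    reflect {2F} {suc (suc (suc i))} _ e = contradiction e (s≁ (g∈ i))
    reflect {suc (suc (suc i))} {suc (suc (suc j))} _ e = contradiction e (indep (g∈ i) (g∈ j))
    reflect {1F} {1F} (s≤s ())
    reflect {2F} {1F} (s≤s ())
    reflect {2F} {2F} (s≤s (s≤s ()))
    reflect {suc (suc (suc _))} {1F} (s≤s ())
    reflect {suc (suc (suc _))} {2F} (s≤s (s≤s ()))
    distinct : ∀ {x y} → x <ᶠ y → f x ≢ f y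
    distinct {0F} {1F}                _ = Adj⇒≢ uv
    distinct {0F} {2F}                _ = Adj⇒≢ us
    distinct {0F} {suc (suc (suc i))} _ = Adj⇒≢ (u~ (g∈ i))
    distinct {1F} {2F}                _ = Adj⇒≢ vs
    -- s is adjacent to v but to no leaf; in the next clause v separates s from the leaves.
    distinct {1F} {suc (suc (suc i))} _ = separated⇒≢ vs (s≁ (g∈ i) ∘ Adj-sym)
    distinct {2F} {suc (suc (suc i))} _ = separated⇒≢ (Adj-sym vs) (v≁ (g∈ i) ∘ Adj-sym)
    distinct {suc (suc (suc i))} {suc (suc (suc j))} (s≤s (s≤s (s≤s i<j))) =
      AllPairs-lookup unique
        (subst₂ _<_ (sym (toℕ-inject≤ i ℓ≤)) (sym (toℕ-inject≤ j ℓ≤)) i<j)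
    distinct {1F} {1F} (s≤s ())
    distinct {2F} {1F} (s≤s ())
    distinct {2F} {2F} (s≤s (s≤s ()))
    distinct {suc (suc (suc _))} {1F} (s≤s ())
    distinct {suc (suc (suc _))} {2F} (s≤s (s≤s ()))

-- Critical graphs with at least two vertices.

module _ {k ℓ m} (G : Graph (2 + m)) (critical : VertexCritical k G)
         (free : ⟨ 2P₂ , squid₃ ℓ ⟩-free G) where
  open Graph G renaming (sym to Adj-sym; irrefl to Adj-irrefl)

  private
    V : Set
    V = Fin (2 + m)
    colour : V → Fin k
    colour = proj₁ (proj₁ (proj₁ critical))
    proper : ∀ {x y} → Adj x y → colour x ≢ colour y
    proper = proj₂ (proj₁ (proj₁ critical))

  -- Otherwise N(s) ⊆ N(t), and a colouring of G ─ s extends to s by the colour of t.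
  separator : ∀ {s t} → s ≢ t → ∃ λ w → Adj s w × ¬ Adj w t
  separator {s} {t} s≢t with any? (λ w → adj? s w ×-dec ¬? (adj? w t))
  ... | yes w = w
  ... | no ∄w with proj₂ critical s
  ...   | j , ((c , c-proper) , _) , j<k = contradiction
      (proj₂ (proj₁ critical) j (c ∘ proj₁ ∘ fold , λ {x} {y} → c-proper ∘ fold-Adj x y))
      (<⇒≱ j<k)
    where
    -- The retraction that sends s to t and fixes every other vertex, written in the vertices of
    -- `G ─ s`; the sum records which case applies.
    fold : ∀ x → ∃ λ y → punchIn s y ≡ x ⊎ (s ≡ x × punchIn s y ≡ t)
    fold x with s ≟ x
    ... | yes s≡x = punchOut s≢t , inj₂ (s≡x , punchIn-punchOut s≢t)
    ... | no s≢x  = punchOut s≢x , inj₁ (punchIn-punchOut s≢x)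
    N[s]⊆N[t] : ∀ {w} → Adj s w → Adj w t
    N[s]⊆N[t] {w} sw = decidable-stable (adj? w t) λ ¬wt → ∄w (w , sw , ¬wt)
    fold-Adj : ∀ x y → Adj x y → Adj (punchIn s (proj₁ (fold x))) (punchIn s (proj₁ (fold y)))
    fold-Adj x y a with fold x | fold y
    ... | _ , inj₁ refl          | _ , inj₁ refl        = a
    ... | _ , inj₁ refl          | _ , inj₂ (refl , eq) rewrite eq = N[s]⊆N[t] (Adj-sym a)
    ... | _ , inj₂ (refl , eq)   | _ , inj₁ refl        rewrite eq = Adj-sym (N[s]⊆N[t] a)
    ... | _ , inj₂ (refl , _)    | _ , inj₂ (refl , _)  = contradiction a (Adj-irrefl refl)

  -- Since the order is at least 2, there is another vertex to separate s from.
  neighbour : ∀ s → ∃ (Adj s)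
  neighbour s = let w , sw , _ = separator (≢-sym (punchInᵢ≢i s zero)) in w , sw

  private
    -- A total form of `separator`, with an arbitrary neighbour at t = s, so that separators form a
    -- function on all of `V` that can be passed to `cover`.
    separating : ∀ s t → ∃ λ w → Adj s w × (s ≢ t → ¬ Adj w t)
    separating s t with s ≟ t
    ... | yes s≡t = let w , sw = neighbour s in w , sw , contradiction s≡t
    ... | no s≢t  = let w , sw , ¬wt = separator s≢t in w , sw , λ _ → ¬wt

  -- Neighbourhoods traced on an independent set.

  module _ {S : List V} (S-unique : Unique S)
           (S-independent : ∀ {x y} → x ∈ S → y ∈ S → ¬ Adj x y) where

    private
      degree codegree : V → ℕ
      degree   u = length (filter (adj? u) S)
      codegree u = length (filter (¬? ∘ adj? u) S)

    -- Otherwise the edges up and vq induce a `2P₂`, since p and q both lie in the independent set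
    -- S.
    nonadjacent⇒nested : ∀ {u v p} → ¬ Adj u v → p ∈ S → Adj u p → ¬ Adj v p →
      ∀ {q} → q ∈ S → Adj v q → Adj u q
    nonadjacent⇒nested {u} ¬uv p∈S up ¬vp {q} q∈S vq = decidable-stable (adj? u q) λ ¬uq →
      proj₁ free (2P₂-induced G up vq ¬uv ¬uq (¬vp ∘ Adj-sym) (S-independent p∈S q∈S))

    nonadjacent⇒degree-< : ∀ {u v p} → ¬ Adj u v → p ∈ S → Adj u p → ¬ Adj v p →
      degree v < degree u
    nonadjacent⇒degree-< {u} {v} ¬uv p∈S up ¬vp =
      length-filter-mono-< (adj? v) (adj? u) (nonadjacent⇒nested ¬uv p∈S up ¬vp) p∈S ¬vp up

    nonadjacent⇒codegree-< : ∀ {u v p} → ¬ Adj u v → p ∈ S → Adj u p → ¬ Adj v p →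
      codegree u < codegree v
    nonadjacent⇒codegree-< {u} {v} ¬uv p∈S up ¬vp =
      length-filter-mono-< (¬? ∘ adj? u) (¬? ∘ adj? v)
        (λ q∈S ¬uq → ¬uq ∘ nonadjacent⇒nested ¬uv p∈S up ¬vp q∈S) p∈S (λ ¬up → ¬up up) ¬vp

    module _ (s : V) where

      tightest : V
      -- The default is itself a neighbour of s, which `tightest-adj` relies on.
      tightest = argmin degree (proj₁ (neighbour s)) (filter (adj? s) (allFin _))

      tightest-adj : Adj s tightest
      tightest-adj = argmin-all degree (proj₂ (neighbour s))
        (All.tabulate (proj₂ ∘ ∈-filter⁻ (adj? s) {xs = allFin _}))

      tightest-min : ∀ {w} → Adj s w → degree tightest ≤ degree w
      tightest-min sw = All.lookup
        (f[argmin]≤f[xs] {f = degree} (proj₁ (neighbour s)) (filter (adj? s) (allFin _)))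
        (∈-filter⁺ (adj? s) (∈-allFin _) sw)

    module _ {s} (s∈S : s ∈ S) where

      private
        u : V
        u = tightest s
        N : List V
        N = filter (adj? u) S
        others : List V
        others = filter (¬? ∘ (s ≟_)) N
        N-unique : Unique N
        N-unique = Unique.filter⁺ (adj? u) S-unique
        others-unique : Unique others
        others-unique = Unique.filter⁺ (¬? ∘ (s ≟_)) N-unique
        w : V → V
        w = proj₁ ∘ separating s
        s~w : ∀ t → Adj s (w t)
        s~w = proj₁ ∘ proj₂ ∘ separating s
        others⁻ : ∀ {t} → t ∈ others → t ∈ S × Adj u t × s ≢ t
        others⁻ t∈ =
          let t∈N , s≢t = ∈-filter⁻ (¬? ∘ (s ≟_)) t∈
              t∈S , ut  = ∈-filter⁻ (adj? u) t∈N
          in t∈S , ut , s≢t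
        w≁ : ∀ {t} → t ∈ others → ¬ Adj (w t) t
        w≁ t∈ = let _ , _ , s≢t = others⁻ t∈ in proj₂ (proj₂ (separating s _)) s≢t
        -- If u and w t were nonadjacent, then t, lying in A_u but not in A_(w t), would make A_(w
        -- t) strictly smaller than A_u. But w t is a neighbour of s, and u was chosen with A_u
        -- smallest.
        u~w : ∀ {t} → t ∈ others → Adj u (w t)
        u~w {t} t∈ with adj? u (w t)
        ... | yes uw = uw
        ... | no ¬uw = let t∈S , ut , _ = others⁻ t∈ in contradiction
          (tightest-min s (s~w t)) (<⇒≱ (nonadjacent⇒degree-< ¬uw t∈S ut (w≁ t∈)))
        missed? : ∀ t → Decidable (λ x → ¬ Adj (w t) x)
        missed? t = ¬? ∘ adj? (w t)

        -- The squid's triangle is u, w t, s; its leaves are the missed vertices.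
        few-missed : ∀ {t} → t ∈ others → length (filter (missed? t) others) ≤ ℓ
        few-missed {t} t∈ with length (filter (missed? t) others) ≤? ℓ
        ... | yes le = le
        ... | no nle = contradiction
          (squid-induced G missed (Unique.filter⁺ (missed? t) others-unique) (≰⇒≥ nle)
            (u~w t∈) (Adj-sym (tightest-adj s)) (Adj-sym (s~w t))
            (λ x∈ → proj₁ (proj₂ (others⁻ (proj₁ (missed⁻ x∈)))))
            (λ x∈ → proj₂ (missed⁻ x∈))
            (λ x∈ → S-independent s∈S (missed⊆S x∈))
            (λ x∈ y∈ → S-independent (missed⊆S x∈) (missed⊆S y∈)))
          (proj₂ free)
          where
          missed : List V
          missed = filter (missed? t) others
          missed⁻ : ∀ {x} → x ∈ missed → x ∈ others × ¬ Adj (w t) x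
          missed⁻ = ∈-filter⁻ (missed? t)
          missed⊆S : ∀ {x} → x ∈ missed → x ∈ S
          missed⊆S = proj₁ ∘ others⁻ ∘ proj₁ ∘ missed⁻

        -- Here x accounts for what `w x` misses. If `w x` sees y, which `w y` misses, and the two
        -- are nonadjacent, then A_(w y) lies properly inside A_(w x), so `w y` misses more.
        differ : ∀ {x y} → x ∈ others → y ∈ others → ¬ ¬ Adj (w x) y →
          colour (w x) ≢ colour (w y) ⊎ codegree (w x) < codegree (w y)
        differ {x} {y} x∈ y∈ ¬¬wxy with adj? (w x) (w y)
        ... | yes a = inj₁ (proper a)
        ... | no ¬a = inj₂ (nonadjacent⇒codegree-< ¬a (proj₁ (others⁻ y∈))
          (decidable-stable (adj? (w x) y) ¬¬wxy) (w≁ y∈))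

      tightest-degree : degree (tightest s) ≤ 1 + k * ℓ
      tightest-degree = begin
        length N                                   ≡⟨ length-filter-split (s ≟_) N ⟩
        length (filter (s ≟_) N) + length others   ≤⟨ +-mono-≤ at-s away ⟩
        1 + k * ℓ                                  ∎
        where
        open ≤-Reasoning
        -- s is adjacent to every `w t`, so no missed set contains it and it is counted apart.
        at-s : length (filter (s ≟_) N) ≤ 1
        at-s = Unique-constant⇒length≤1 (Unique.filter⁺ (s ≟_) N-unique)
          (proj₂ ∘ ∈-filter⁻ (s ≟_) {xs = N})
        away : length others ≤ k * ℓ
        away = cover (colour ∘ w) (codegree ∘ w) missed? differ few-missed

    independent-bound : length S ≤ k * (1 + k * ℓ)
    independent-bound =
      cover (colour ∘ tightest) (degree ∘ tightest) (adj? ∘ tightest) differ tightest-degree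
      where
      differ : ∀ {x y} → x ∈ S → y ∈ S → ¬ Adj (tightest x) y →
        colour (tightest x) ≢ colour (tightest y) ⊎ degree (tightest x) < degree (tightest y)
      differ {x} {y} _ y∈S ¬xy with adj? (tightest x) (tightest y)
      ... | yes a = inj₁ (proper a)
      -- y is adjacent to `tightest y` but not to `tightest x`, so by nestedness the former has
      -- strictly more neighbours in S.
      ... | no ¬a = inj₂ (nonadjacent⇒degree-< (¬a ∘ Adj-sym) y∈S (Adj-sym (tightest-adj y)) ¬xy)

  order-bound : 2 + m ≤ k * (k * (1 + k * ℓ))
  order-bound = subst (_≤ k * (k * (1 + k * ℓ))) (length-tabulate {n = 2 + m} id)
    -- Each vertex accounts for its colour class, so only the first alternative occurs and the
    -- measure can be constant.
    (cover colour (λ _ → 0) (λ x y → colour x ≟ colour y) (λ _ _ → inj₁)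
      λ {x} _ → independent-bound (Unique.filter⁺ (class? x) (Unique.allFin⁺ _))
        λ y∈ z∈ a → proper a (trans (sym (in-class x y∈)) (in-class x z∈)))
    where
    class? : ∀ x → Decidable (λ y → colour x ≡ colour y)
    class? x y = colour x ≟ colour y
    in-class : ∀ x {y} → y ∈ filter (class? x) (allFin _) → colour x ≡ colour y
    in-class x = proj₂ ∘ ∈-filter⁻ (class? x) {xs = allFin _}

-- Enumerating the graphs of bounded order.

-- A code lists, for each vertex, the indicator function of its neighbourhood.
Code : ℕ → Set
Code n = Fin ((2 ^ n) ^ n)

-- An arbitrary code need be neither irreflexive nor symmetric: `E` drops the diagonal and
-- `fromEdges` symmetrises.
decode : ∀ {n} → Code n → Graph n
decode {n} i = fromEdges E (λ x≡y (x≢y , _) → x≢y x≡y)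
  (λ x y → ¬? (x ≟ y) ×-dec (entry x y ≟ 1F))
  where
  entry : Fin n → Fin n → Fin 2
  entry x = finToFun (finToFun i x)
  E : Rel (Fin n) 0ℓ
  E x y = x ≢ y × entry x y ≡ 1F

module _ {n} (G : Graph n) where
  open Graph G renaming (sym to Adj-sym; irrefl to Adj-irrefl)

  private
    indicator : Fin n → Fin n → Fin 2
    indicator x y with adj? x y
    ... | yes _ = 1F
    ... | no _  = 0F

    indicator⁺ : ∀ {x y} → Adj x y → indicator x y ≡ 1F
    indicator⁺ {x} {y} a with adj? x y
    ... | yes _ = refl
    ... | no ¬a = contradiction a ¬a

    indicator⁻ : ∀ {x y} → indicator x y ≡ 1F → Adj x y
    indicator⁻ {x} {y} _ with adj? x y
    indicator⁻ _  | yes a = a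
    indicator⁻ () | no _

  encode : Code n
  encode = funToFin (funToFin ∘ indicator)

  decode-encode : G ≅ decode encode
  decode-encode = id , record
    { isOrderMonomorphism = record
      { isOrderHomomorphism = record
        { cong = id
        ; mono = λ a → fwd (Adj⇒≢ G a , trans (entry≡ _ _) (indicator⁺ a))
        }
      ; injective = id
      ; cancel    = λ
        { (fwd (_ , e)) → indicator⁻ (trans (sym (entry≡ _ _)) e)
        ; (bwd (_ , e)) → Adj-sym (indicator⁻ (trans (sym (entry≡ _ _)) e))
        }
      }
    ; surjective = λ y → y , id
    }
    where
    entry≡ : ∀ x y → finToFun (finToFun encode x) y ≡ indicator x y
    entry≡ x y = trans (cong (λ i → finToFun i y) (finToFun-funToFin (funToFin ∘ indicator) x))
      (finToFun-funToFin (indicator x) y)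

-- Each order has finitely many codes, and every graph is isomorphic to the decoding of its own
-- code.
bounded-order⇒FinitelyMany : ∀ {P : ∀ {n} → Graph n → Set} N →
  (∀ {n} (G : Graph n) → P G → n ≤ N) → FinitelyMany P
bounded-order⇒FinitelyMany N bound = concatMap graphs (upTo (suc N)) , λ {n} G p →
  concatMap⁺ graphs (Any.map (λ { refl → tabulate⁺ (encode G) (decode-encode G) })
    (∈-upTo⁺ (s≤s (bound G p))))
  where
  graphs : ℕ → List (∃ Graph)
  graphs n = tabulate {n = (2 ^ n) ^ n} λ i → n , decode i

theorem5p2 : ∀ (k ℓ : ℕ) → 1 ≤ k → 1 ≤ ℓ →
    FinitelyMany (λ G → VertexCritical k G × ⟨ 2P₂ , squid₃ ℓ ⟩-free G)
theorem5p2 k ℓ _ _ = bounded-order⇒FinitelyMany (1 + k * (k * (1 + k * ℓ))) bound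
  where
  bound : ∀ {n} (G : Graph n) → VertexCritical k G × ⟨ 2P₂ , squid₃ ℓ ⟩-free G →
    n ≤ 1 + k * (k * (1 + k * ℓ))
  bound {zero}        _ _                 = z≤n
  -- The summand 1 in the bound settles the one-vertex graph, where `order-bound` does not apply.
  bound {suc zero}    _ _                 = s≤s z≤n
  bound {suc (suc m)} G (critical , free) = m≤n⇒m≤1+n (order-bound G critical free)
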